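{- Let $n\ge 4$ and let $P_n$ be the path on $n$ vertices with end vertices $u$ and $v$. Then there exists a permutation $\sigma$ of $V(P_n)$ such that: (1) $\sigma$ is a 2-placement of $P_n$; (2) $\sigma(P_n)\subseteq P_n^4$; (3) $dist(u,\sigma(u))=1$ and $dist(v,\sigma(v))\le 1$; (4) every cycle of $\sigma$ has length at most $4$.
   Context: All graphs are finite, simple and undirected; $dist$ denotes the distance in $P_n$. For a graph $G$, a permutation $\sigma$ of $V(G)$ is a 2-placement of $G$ if for every edge $ab\in E(G)$, $\sigma(a)\sigma(b)\notin E(G)$. $G^k$ denotes the $k$-th power of $G$ (same vertex set, distinct vertices adjacent iff their distance in $G$ is at most $k$); $\sigma(G)\subseteq G^k$ means that for every edge $ab$ of $G$, $dist_G(\sigma(a),\sigma(b))\le k$. The cycles of $\sigma$ are those of its disjoint cycle decomposition, fixed points counting as cycles of length $1$. -}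

module Defs where

open import Data.Fin.Base using (Fin; toℕ)
open import Data.Fin.Permutation using (Permutation′; _⟨$⟩ʳ_)
open import Data.List.Base using (List; _∷_; _∷ʳ_; map; length)
open import Data.List.Relation.Unary.Unique.Propositional using (Unique)
open import Data.Nat.Base using (ℕ; zero; suc; _≤_)
open import Data.Nat.Properties using (1+n≢n)
open import Data.Product using (_×_; ∃-syntax; ∃!)
open import Data.Sum.Base using (_⊎_; inj₁; inj₂; swap)
open import Level using (0ℓ)
open import Relation.Binary.Core using (Rel)
open import Relation.Binary.Definitions using (Symmetric; Irreflexive)
open import Relation.Binary.PropositionalEquality.Core using (_≡_; refl; sym)
open import Relation.Nullary.Negation.Core using (¬_)

record Graph (n : ℕ) : Set₁ where
  field
    Adj        : Rel (Fin n) 0ℓ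
    adj-sym    : Symmetric Adj
    adj-irrefl : Irreflexive _≡_ Adj

open Graph public

pathGraph : ∀ n → Graph n
pathGraph n = record
  { Adj        = λ i j → toℕ j ≡ suc (toℕ i) ⊎ toℕ i ≡ suc (toℕ j)
  ; adj-sym    = swap
  ; adj-irrefl = λ { refl (inj₁ e) → 1+n≢n (sym e)
                   ; refl (inj₂ e) → 1+n≢n (sym e) }
  }

module _ {n : ℕ} (G : Graph n) where

  -- A vertex of degree one.
  EndVertex : Fin n → Set
  EndVertex x = ∃! _≡_ (Adj G x)

  data Walk : Fin n → Fin n → ℕ → Set where
    here : ∀ {x} → Walk x x zero
    step : ∀ {x y z d} → Adj G x y → Walk y z d → Walk x z (suc d)

  -- Distance is a relation rather than a function because it is undefined
  -- between vertices in different components; d is unique when it exists.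
  Dist : Fin n → Fin n → ℕ → Set
  Dist x y d = Walk x y d × (∀ m → Walk x y m → d ≤ m)

  Dist≤ : Fin n → Fin n → ℕ → Set
  Dist≤ x y k = ∃[ d ] (Dist x y d × d ≤ k)

  TwoPlacement : Permutation′ n → Set
  TwoPlacement σ = ∀ a b → Adj G a b → ¬ Adj G (σ ⟨$⟩ʳ a) (σ ⟨$⟩ʳ b)

  -- σ(G) ⊆ Gᵏ.  Adjacency in Gᵏ also asks that the two vertices be distinct,
  -- which is automatic here since σ is injective and G has no loops.
  ImageInPower : Permutation′ n → ℕ → Set
  ImageInPower σ k = ∀ a b → Adj G a b → Dist≤ (σ ⟨$⟩ʳ a) (σ ⟨$⟩ʳ b) k

-- The list c₀, …, cₗ₋₁ represents the cycle (c₀ … cₗ₋₁) of σ: its entries are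
-- distinct and σ sends each to the next, the last to the first.  A cycle of
-- length l is represented by its l rotations; [ x ] is a cycle iff σ fixes x.
data IsCycle {n} (σ : Permutation′ n) : List (Fin n) → Set where
  isCycle : ∀ {x xs} → Unique (x ∷ xs) →
            map (σ ⟨$⟩ʳ_) (x ∷ xs) ≡ xs ∷ʳ x →
            IsCycle σ (x ∷ xs)

CyclesBoundedBy : ∀ {n} → Permutation′ n → ℕ → Set
CyclesBoundedBy σ k = ∀ cs → IsCycle σ cs → length cs ≤ k

{-# OPTIONS --safe #-}

-- Number the vertices 0, …, n-1.  The block 1 3 0 2 on four vertices starts at 1 and ends
-- one below its top vertex, so placing it in front of a permutation that again starts
-- at 1 gives a difference of 3 at the junction.  Prepending such blocks to suitable
-- permutations of 4, 5, 6 and 7 vertices settles u = 0 for every n; conjugating by the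
-- reflection of the path settles the other labelling of the ends.

module Submission where

open import Defs
open import Data.Fin.Base using (Fin; zero; suc; toℕ; fromℕ; fromℕ<; inject₁; opposite)
open import Data.Fin.Patterns
open import Data.Fin.Permutation
  using (Permutation′; permutation; _⟨$⟩ʳ_; _⟨$⟩ˡ_; inverseˡ; inverseʳ; reverse; _∘ₚ_)
open import Data.Fin.Properties
  using (all?; toℕ-injective; toℕ-fromℕ; toℕ-fromℕ<; toℕ-inject₁; toℕ<n;
         opposite-prop; opposite-involutive)
  renaming (_≟_ to _≟ᶠ_)
open import Data.List.Base using ([]; _∷_)
open import Data.List.Properties using (∷-injective)
open import Data.List.Relation.Unary.All using ([]; _∷_)
open import Data.List.Relation.Unary.AllPairs using ([]; _∷_)
open import Data.Nat.Base using (ℕ; zero; suc; _+_; _≤_; _<_; z≤n; s≤s; ∣_-_∣)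
open import Data.Nat.Properties
open import Data.Product.Base using (Σ-syntax; _×_; _,_; proj₁; proj₂)
open import Data.Sum.Base using (_⊎_; inj₁; inj₂) renaming (map to map-⊎)
open import Data.Vec.Base using (Vec; []; _∷_; lookup)
open import Function.Base using (_∘_)
open import Relation.Binary.PropositionalEquality
  using (_≡_; _≢_; refl; sym; trans; cong; cong₂; subst; module ≡-Reasoning)
open import Relation.Nullary.Decidable
  using (Dec; yes; no; True; toWitness; from-yes; map′; _×-dec_; _⊎-dec_; _→-dec_)
open import Relation.Nullary.Negation using (contradiction)

private
  variable
    n d : ℕ

-- A closed form for the distance in the path. Unlike `Dist` it computes, so finite cases can be
-- settled by decision procedures.
gap : Fin n → Fin n → ℕ
gap i j = ∣ toℕ i - toℕ j ∣

adj⇒gap≡1 : {i j : Fin n} → Adj (pathGraph n) i j → gap i j ≡ 1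
adj⇒gap≡1 {i = i} (inj₁ e) rewrite e = ∣m-1+m∣≡1 (toℕ i)
  where
  ∣m-1+m∣≡1 : ∀ m → ∣ m - suc m ∣ ≡ 1
  ∣m-1+m∣≡1 m = trans (cong (∣ m -_∣) (+-comm 1 m)) (∣m-m+n∣≡n m 1)
adj⇒gap≡1 {i = i} {j} (inj₂ e) =
  trans (∣-∣-comm (toℕ i) (toℕ j)) (adj⇒gap≡1 {i = j} {i} (inj₁ e))

-- Each step changes the position by exactly one, so the triangle inequality bounds the gap by the
-- length. This is the minimality half of `Dist`.
walk⇒gap≤ : {i j : Fin n} → Walk (pathGraph n) i j d → gap i j ≤ d
walk⇒gap≤ {i = i} here = ≤-reflexive (∣n-n∣≡0 (toℕ i))
walk⇒gap≤ {n} {i = i} {j} (step {y = k} a w) = ≤-trans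
  (∣-∣-triangle (toℕ i) (toℕ k) (toℕ j))
  (+-mono-≤ (≤-reflexive (adj⇒gap≡1 {n} {i} {k} a)) (walk⇒gap≤ w))

walkUp : ∀ d (i j : Fin n) → d + toℕ i ≡ toℕ j → Walk (pathGraph n) i j d
walkUp zero i j e with refl ← toℕ-injective e = here
walkUp {n} (suc d) i j e = step (inj₁ (toℕ-fromℕ< i+1<n)) (walkUp d _ j e′)
  where
  e″ : d + suc (toℕ i) ≡ toℕ j
  e″ = trans (+-suc d (toℕ i)) e
  i+1<n : suc (toℕ i) < n
  i+1<n = ≤-<-trans (m+n≤o⇒n≤o d (≤-reflexive e″)) (toℕ<n j)
  e′ : d + toℕ (fromℕ< i+1<n) ≡ toℕ j
  e′ = trans (cong (d +_) (toℕ-fromℕ< i+1<n)) e″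

walkDown : ∀ d (i j : Fin n) → toℕ i ≡ d + toℕ j → Walk (pathGraph n) i j d
walkDown zero i j e with refl ← toℕ-injective e = here
walkDown {n} (suc d) i j e = step (inj₂ (trans e (cong suc (sym (toℕ-fromℕ< d+j<n)))))
                                  (walkDown d _ j (toℕ-fromℕ< d+j<n))
  where
  d+j<n : d + toℕ j < n
  d+j<n = ≤-trans (≤-reflexive (sym e)) (<⇒≤ (toℕ<n i))

dist≡gap : (i j : Fin n) → Dist (pathGraph n) i j (gap i j)
dist≡gap {n} i j = walk (≤-total (toℕ i) (toℕ j)) , λ _ → walk⇒gap≤
  where
  walk : toℕ i ≤ toℕ j ⊎ toℕ j ≤ toℕ i → Walk (pathGraph n) i j (gap i j)
  walk (inj₁ i≤j) = walkUp _ i j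
    (trans (cong (_+ toℕ i) (m≤n⇒∣m-n∣≡n∸m i≤j)) (m∸n+n≡m i≤j))
  walk (inj₂ j≤i) = walkDown _ i j
    (sym (trans (cong (_+ toℕ j) (m≤n⇒∣n-m∣≡n∸m j≤i)) (m∸n+n≡m j≤i)))

gap≤⇒dist≤ : ∀ {k} (i j : Fin n) → gap i j ≤ k → Dist≤ (pathGraph n) i j k
gap≤⇒dist≤ i j gap≤k = gap i j , dist≡gap i j , gap≤k

-- An interior vertex has a neighbour on either side; uniqueness would identify the two, although
-- their numbers differ by 2.
endVertex⇒extremal : (u : Fin (suc n)) → EndVertex (pathGraph (suc n)) u →
                     u ≡ zero ⊎ u ≡ fromℕ n
endVertex⇒extremal zero _ = inj₁ refl
endVertex⇒extremal {n} (suc i) (_ , _ , unique) with suc i ≟ᶠ fromℕ n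
... | yes e = inj₂ e
... | no ¬e = contradiction i≡i+2 (m≢1+n+m (toℕ i) {1})
  where
  i+2≤n : suc (suc (toℕ i)) ≤ n
  i+2≤n = ≤∧≢⇒< (toℕ<n i) λ e → ¬e (toℕ-injective (trans e (sym (toℕ-fromℕ n))))
  below≡above : inject₁ i ≡ fromℕ< (s≤s i+2≤n)
  below≡above = trans (sym (unique (inj₂ (cong suc (sym (toℕ-inject₁ i))))))
                      (unique (inj₁ (toℕ-fromℕ< (s≤s i+2≤n))))
  i≡i+2 : toℕ i ≡ suc (suc (toℕ i))
  i≡i+2 = trans (sym (toℕ-inject₁ i))
                (trans (cong toℕ below≡above) (toℕ-fromℕ< (s≤s i+2≤n)))

-- Position and reflected position satisfy `complement`. Translating by `suc (toℕ i)` turns one side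
-- into `n`, which is rewritten through `j`; cancelling `j′` leaves the original gap.
gap-opposite : (i j : Fin n) → gap (opposite i) (opposite j) ≡ gap i j
gap-opposite {n} i j = begin
  ∣ i′ - j′ ∣                                  ≡⟨ ∣m+n-m+o∣≡∣n-o∣ (suc (toℕ i)) i′ j′ ⟨
  ∣ suc (toℕ i) + i′ - suc (toℕ i) + j′ ∣      ≡⟨ cong (∣_- suc (toℕ i) + j′ ∣) (trans (complement i) (sym (complement j))) ⟩
  ∣ suc (toℕ j) + j′ - suc (toℕ i) + j′ ∣      ≡⟨ cong₂ ∣_-_∣ (+-comm (suc (toℕ j)) j′) (+-comm (suc (toℕ i)) j′) ⟩
  ∣ j′ + suc (toℕ j) - j′ + suc (toℕ i) ∣      ≡⟨ ∣m+n-m+o∣≡∣n-o∣ j′ (suc (toℕ j)) (suc (toℕ i)) ⟩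
  ∣ toℕ j - toℕ i ∣                            ≡⟨ ∣-∣-comm (toℕ j) (toℕ i) ⟩
  ∣ toℕ i - toℕ j ∣                            ∎
  where
  open ≡-Reasoning
  i′ = toℕ (opposite i)
  j′ = toℕ (opposite j)
  complement : (k : Fin n) → suc (toℕ k) + toℕ (opposite k) ≡ n
  complement k = trans (cong (suc (toℕ k) +_) (opposite-prop k)) (m+[n∸m]≡n (toℕ<n k))

-- A decidable form of the four conclusions. `spread` merges (1) and (2): the images of neighbours
-- are neither adjacent nor more than 4 apart.
record Suitable (σ : Permutation′ n) (u v : Fin n) : Set where
  field
    spread    : ∀ i j → gap i j ≡ 1 →
                2 ≤ gap (σ ⟨$⟩ʳ i) (σ ⟨$⟩ʳ j) × gap (σ ⟨$⟩ʳ i) (σ ⟨$⟩ʳ j) ≤ 4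
    start     : gap u (σ ⟨$⟩ʳ u) ≡ 1
    end       : gap v (σ ⟨$⟩ʳ v) ≤ 1
    -- Equivalent to all cycle lengths being at most 4: 1 and 3 divide 3, 2 and 4 divide 4.
    recurrent : ∀ i → σ ⟨$⟩ʳ (σ ⟨$⟩ʳ (σ ⟨$⟩ʳ i)) ≡ i
                    ⊎ σ ⟨$⟩ʳ (σ ⟨$⟩ʳ (σ ⟨$⟩ʳ (σ ⟨$⟩ʳ i))) ≡ i

open Suitable

suitable? : (σ : Permutation′ n) (u v : Fin n) → Dec (Suitable σ u v)
suitable? σ u v = map′
  (λ (a , b , c , e) → record { spread = a ; start = b ; end = c ; recurrent = e })
  (λ s → spread s , start s , end s , recurrent s)
  (  (all? λ i → all? λ j → (gap i j ≟ 1) →-dec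
       ((2 ≤? gap (σ ⟨$⟩ʳ i) (σ ⟨$⟩ʳ j)) ×-dec (gap (σ ⟨$⟩ʳ i) (σ ⟨$⟩ʳ j) ≤? 4)))
  ×-dec (gap u (σ ⟨$⟩ʳ u) ≟ 1)
  ×-dec (gap v (σ ⟨$⟩ʳ v) ≤? 1)
  ×-dec (all? λ i → (σ ⟨$⟩ʳ (σ ⟨$⟩ʳ (σ ⟨$⟩ʳ i)) ≟ᶠ i)
              ⊎-dec (σ ⟨$⟩ʳ (σ ⟨$⟩ʳ (σ ⟨$⟩ʳ (σ ⟨$⟩ʳ i))) ≟ᶠ i)))

-- In a cycle with at least five entries the fourth and fifth are the images of `x` under the third
-- and fourth powers of `σ`. Both differ from `x`, against `recurrent`.
suitable⇒cyclesBounded : {σ : Permutation′ n} {u v : Fin n} →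
                         Suitable σ u v → CyclesBoundedBy σ 4
suitable⇒cyclesBounded s (_ ∷ []) _ = s≤s z≤n
suitable⇒cyclesBounded s (_ ∷ _ ∷ []) _ = s≤s (s≤s z≤n)
suitable⇒cyclesBounded s (_ ∷ _ ∷ _ ∷ []) _ = s≤s (s≤s (s≤s z≤n))
suitable⇒cyclesBounded s (_ ∷ _ ∷ _ ∷ _ ∷ []) _ = ≤-refl
suitable⇒cyclesBounded {σ = σ} s (x ∷ a ∷ b ∷ c ∷ e ∷ _)
  (isCycle ((_ ∷ _ ∷ x≢c ∷ x≢e ∷ _) ∷ _) eq)
  with σx≡a , eq ← ∷-injective eq
  with σa≡b , eq ← ∷-injective eq
  with σb≡c , eq ← ∷-injective eq
  with σc≡e , _  ← ∷-injective eq
  with refl ← σx≡a | refl ← σa≡b | refl ← σb≡c | refl ← σc≡e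
  with recurrent s x
... | inj₁ σ³x≡x = contradiction (sym σ³x≡x) x≢c
... | inj₂ σ⁴x≡x = contradiction (sym σ⁴x≡x) x≢e

reflect : Permutation′ n → Permutation′ n
reflect σ = reverse ∘ₚ σ ∘ₚ reverse

-- Reflection preserves gaps, and powers of a conjugate are conjugates of powers.
reflect-suitable : {σ : Permutation′ n} {u v : Fin n} →
                   Suitable σ u v → Suitable (reflect σ) (opposite u) (opposite v)
reflect-suitable {n} {σ} {u} {v} s = record
  { spread    = λ i j e → subst (λ k → 2 ≤ k × k ≤ 4) (sym (gap-opposite (f (opposite i)) (f (opposite j))))
                  (spread s (opposite i) (opposite j) (trans (gap-opposite i j) e))
  ; start     = trans (moved u) (start s)
  ; end       = subst (_≤ 1) (sym (moved v)) (end s)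
  ; recurrent = λ i → map-⊎ (λ e → trans (cube i) (back e)) (λ e → trans (fourth i) (back e))
                        (recurrent s (opposite i))
  }
  where
  f : Fin n → Fin n
  f = σ ⟨$⟩ʳ_
  f′ : Fin n → Fin n
  f′ = reflect σ ⟨$⟩ʳ_
  push : ∀ i → f′ (opposite i) ≡ opposite (f i)
  push i = cong (opposite ∘ f) (opposite-involutive i)
  cube : ∀ i → f′ (f′ (f′ i)) ≡ opposite (f (f (f (opposite i))))
  cube i = trans (cong f′ (push _)) (push _)
  fourth : ∀ i → f′ (f′ (f′ (f′ i))) ≡ opposite (f (f (f (f (opposite i)))))
  fourth i = trans (cong f′ (cube i)) (push _)
  back : ∀ {i j} → j ≡ opposite i → opposite j ≡ i
  back {i} e = trans (cong opposite e) (opposite-involutive i)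
  moved : ∀ w → gap (opposite w) (f′ (opposite w)) ≡ gap w (f w)
  moved w = trans (cong (gap (opposite w)) (push w)) (gap-opposite w (f w))

-- The block is the single 4-cycle 0 → 1 → 3 → 2 → 0; `σ` acts on the remaining vertices, shifted by
-- 4.
prepend : Permutation′ n → Permutation′ (4 + n)
prepend {n} σ = permutation to from to∘from from∘to
  where
  to : Fin (4 + n) → Fin (4 + n)
  to 0F = 1F
  to 1F = 3F
  to 2F = 0F
  to 3F = 2F
  to (suc (suc (suc (suc i)))) = suc (suc (suc (suc (σ ⟨$⟩ʳ i))))
  from : Fin (4 + n) → Fin (4 + n)
  from 0F = 2F
  from 1F = 0F
  from 2F = 3F
  from 3F = 1F
  from (suc (suc (suc (suc i)))) = suc (suc (suc (suc (σ ⟨$⟩ˡ i))))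
  to∘from : ∀ i → to (from i) ≡ i
  to∘from 0F = refl
  to∘from 1F = refl
  to∘from 2F = refl
  to∘from 3F = refl
  to∘from (suc (suc (suc (suc i)))) = cong (λ k → suc (suc (suc (suc k)))) (inverseʳ σ)
  from∘to : ∀ i → from (to i) ≡ i
  from∘to 0F = refl
  from∘to 1F = refl
  from∘to 2F = refl
  from∘to 3F = refl
  from∘to (suc (suc (suc (suc i)))) = cong (λ k → suc (suc (suc (suc k)))) (inverseˡ σ)

prepend-suitable : {σ : Permutation′ (suc n)} → Suitable σ zero (fromℕ n) →
                   Suitable (prepend σ) zero (fromℕ (4 + n))
prepend-suitable {n} {σ} s = record
  { spread = spread′ ; start = refl ; end = end s ; recurrent = recurrent′ }
  where
  τ = prepend σ ⟨$⟩ʳ_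
  -- Vertex 3 goes to 2 and vertex 4 to 4 + σ(0), so their gap computes to 2 + σ(0), where σ(0) = 1
  -- by `start`.
  junction : 2 ≤ 2 + toℕ (σ ⟨$⟩ʳ zero) × 2 + toℕ (σ ⟨$⟩ʳ zero) ≤ 4
  junction = subst (λ k → 2 ≤ 2 + k × 2 + k ≤ 4) (sym (start s))
               (from-yes ((2 ≤? 3) ×-dec (3 ≤? 4)))
  spread′ : ∀ i j → gap i j ≡ 1 → 2 ≤ gap (τ i) (τ j) × gap (τ i) (τ j) ≤ 4
  -- For the pairs not listed the gap computes to a number other than 1, so the hypothesis is
  -- absurd.
  spread′ 0F 1F _ = from-yes ((2 ≤? 2) ×-dec (2 ≤? 4))
  spread′ 1F 0F _ = from-yes ((2 ≤? 2) ×-dec (2 ≤? 4))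
  spread′ 1F 2F _ = from-yes ((2 ≤? 3) ×-dec (3 ≤? 4))
  spread′ 2F 1F _ = from-yes ((2 ≤? 3) ×-dec (3 ≤? 4))
  spread′ 2F 3F _ = from-yes ((2 ≤? 2) ×-dec (2 ≤? 4))
  spread′ 3F 2F _ = from-yes ((2 ≤? 2) ×-dec (2 ≤? 4))
  spread′ 3F 4F _ = junction
  spread′ 4F 3F _ = junction
  spread′ (suc (suc (suc (suc i)))) (suc (suc (suc (suc j)))) e = spread s i j e
  recurrent′ : ∀ i → τ (τ (τ i)) ≡ i ⊎ τ (τ (τ (τ i))) ≡ i
  recurrent′ 0F = inj₂ refl
  recurrent′ 1F = inj₂ refl
  recurrent′ 2F = inj₂ refl
  recurrent′ 3F = inj₂ refl
  recurrent′ (suc (suc (suc (suc i)))) = map-⊎ lift lift (recurrent s i)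
    where
    lift : ∀ {j k : Fin (suc n)} → j ≡ k →
           _≡_ {A = Fin (4 + suc n)} (suc (suc (suc (suc j)))) (suc (suc (suc (suc k))))
    lift refl = refl

-- For concrete tables the two inverse laws are decided by evaluation, which fills the implicit
-- arguments.
fromTables : (f g : Vec (Fin n) n) →
             {True (all? λ i → lookup f (lookup g i) ≟ᶠ i)} →
             {True (all? λ i → lookup g (lookup f i) ≟ᶠ i)} →
             Permutation′ n
fromTables f g {fg} {gf} =
  permutation (lookup f) (lookup g) (toWitness fg) (toWitness gf)

-- Induction in steps of 4, with one base case for each residue.
suitable : ∀ m → Σ[ σ ∈ Permutation′ (4 + m) ] Suitable σ zero (fromℕ (3 + m))
suitable 0 = σ , from-yes (suitable? σ zero (fromℕ 3))
  where
  σ = fromTables (1F ∷ 3F ∷ 0F ∷ 2F ∷ []) (2F ∷ 0F ∷ 3F ∷ 1F ∷ [])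
suitable 1 = σ , from-yes (suitable? σ zero (fromℕ 4))
  where
  -- The 4-cycle 0 → 1 → 4 → 3 → 0 with 2 fixed; the case of six vertices also fixes the end vertex
  -- 5.
  σ = fromTables (1F ∷ 4F ∷ 2F ∷ 0F ∷ 3F ∷ []) (3F ∷ 0F ∷ 2F ∷ 4F ∷ 1F ∷ [])
suitable 2 = σ , from-yes (suitable? σ zero (fromℕ 5))
  where
  σ = fromTables (1F ∷ 4F ∷ 2F ∷ 0F ∷ 3F ∷ 5F ∷ []) (3F ∷ 0F ∷ 2F ∷ 4F ∷ 1F ∷ 5F ∷ [])
suitable 3 = σ , from-yes (suitable? σ zero (fromℕ 6))
  where
  -- Two 3-cycles, 0 → 1 → 4 → 0 and 2 → 6 → 5 → 2, with 3 fixed.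
  σ = fromTables (1F ∷ 4F ∷ 6F ∷ 3F ∷ 0F ∷ 2F ∷ 5F ∷ []) (4F ∷ 0F ∷ 5F ∷ 3F ∷ 1F ∷ 6F ∷ 2F ∷ [])
suitable (suc (suc (suc (suc m)))) with suitable m
... | σ , s = prepend σ , prepend-suitable s

-- The conditions at `u` and `v` differ, so the two labellings of the ends are treated separately.
suitable-ends : ∀ m {u v : Fin (4 + m)} → u ≢ v →
                u ≡ zero ⊎ u ≡ fromℕ (3 + m) → v ≡ zero ⊎ v ≡ fromℕ (3 + m) →
                Σ[ σ ∈ Permutation′ (4 + m) ] Suitable σ u v
suitable-ends m u≢v (inj₁ refl) (inj₁ refl) = contradiction refl u≢v
suitable-ends m u≢v (inj₁ refl) (inj₂ refl) = suitable m
suitable-ends m u≢v (inj₂ refl) (inj₂ refl) = contradiction refl u≢v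
suitable-ends m u≢v (inj₂ refl) (inj₁ refl) with suitable m
-- `opposite zero` computes to the last vertex, so `u` already matches; `v` is
-- `opposite (opposite zero)` and is transported to `zero`.
... | σ , s = reflect σ , subst (Suitable (reflect σ) _) (opposite-involutive zero) (reflect-suitable s)

theorem1p6 : (n : ℕ) → 4 ≤ n →
    (u v : Fin n) → EndVertex (pathGraph n) u → EndVertex (pathGraph n) v → u ≢ v →
    Σ[ σ ∈ Permutation′ n ]
    ( TwoPlacement (pathGraph n) σ
    × ImageInPower (pathGraph n) σ 4
    × (Dist (pathGraph n) u (σ ⟨$⟩ʳ u) 1 × Dist≤ (pathGraph n) v (σ ⟨$⟩ʳ v) 1)
    × CyclesBoundedBy σ 4 )
theorem1p6 n@(suc (suc (suc (suc m)))) (s≤s (s≤s (s≤s (s≤s _)))) u v end-u end-v u≢v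
  with suitable-ends m u≢v (endVertex⇒extremal u end-u) (endVertex⇒extremal v end-v)
... | σ , s = σ
  -- Adjacent images would have gap 1, but `spread` makes it at least 2.
  , (λ a b ab σaσb → <⇒≢ (proj₁ (apart a b ab)) (sym (adj⇒gap≡1 {n} {σ ⟨$⟩ʳ a} {σ ⟨$⟩ʳ b} σaσb)))
  , (λ a b ab → gap≤⇒dist≤ _ _ (proj₂ (apart a b ab)))
  , (subst (Dist (pathGraph n) u (σ ⟨$⟩ʳ u)) (start s) (dist≡gap u (σ ⟨$⟩ʳ u))
    , gap≤⇒dist≤ _ _ (end s))
  , suitable⇒cyclesBounded s
  where
  apart : ∀ a b → Adj (pathGraph n) a b →
          2 ≤ gap (σ ⟨$⟩ʳ a) (σ ⟨$⟩ʳ b) × gap (σ ⟨$⟩ʳ a) (σ ⟨$⟩ʳ b) ≤ 4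
  apart a b ab = spread s a b (adj⇒gap≡1 {n} {a} {b} ab)
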